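{- Let $G_1$ be a group, $n,m\ge0$, $G\le G_1^n$ a subgroup, $w(\bar x,\bar y)$ a group word in the variables $\bar x=(x_1,\dots,x_n)$, $\bar y=(y_1,\dots,y_m)$ and their inverses, and $\bar g\in G_1^m$, $c\in G_1$. If the set $\{\bar h\in G:w(\bar h,\bar g)=c\}$ is $2$-large in $G$, then $w(\bar h,\bar 1)=1$ for all $\bar h\in G\cap Z(G_1)^n$, where $\bar 1=(1,\dots,1)\in G_1^m$.
   Context: A subset $X\subseteq G$ is $2$-large in $G$ if $\bar aX\cap\bar bX\ne\emptyset$ for all $\bar a,\bar b\in G$. -}

module Defs where

open import Algebra.Bundles using (Group)
import Algebra.Construct.Pointwise as Pointwise
open import Data.Fin.Base using (Fin)
open import Data.List.Base using (List; []; _∷_)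
open import Data.Nat.Base using (ℕ)
open import Data.Product.Base using (∃-syntax; _×_)
open import Data.Sum.Base using (_⊎_; [_,_]′)
open import Level using (Level; _⊔_; suc)
open import Relation.Binary.Definitions using (_Respects_)
open import Relation.Unary using (Pred; _∈_; _⊆_; _∩_; Satisfiable)

infix 8 _^ᴳ_

_^ᴳ_ : ∀ {c ℓ} → Group c ℓ → ℕ → Group c ℓ
𝔾 ^ᴳ n = Pointwise.group (Fin n) 𝔾

module _ {c ℓ} (𝔾 : Group c ℓ) where
  open Group 𝔾

  -- Equality of elements is the group's setoid equality, so a subset has to
  -- respect it.
  record Subgroup (p : Level) : Set (c ⊔ ℓ ⊔ suc p) where
    field
      ⟦_⟧       : Pred Carrier p
      resp-≈    : ⟦_⟧ Respects _≈_
      ε-closed  : ε ∈ ⟦_⟧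
      ∙-closed  : ∀ {x y} → x ∈ ⟦_⟧ → y ∈ ⟦_⟧ → x ∙ y ∈ ⟦_⟧
      ⁻¹-closed : ∀ {x} → x ∈ ⟦_⟧ → x ⁻¹ ∈ ⟦_⟧

  Centre : Pred Carrier (c ⊔ ℓ)
  Centre z = ∀ x → z ∙ x ≈ x ∙ z

  LeftTranslate : ∀ {q} → Carrier → Pred Carrier q → Pred Carrier (c ⊔ ℓ ⊔ q)
  LeftTranslate a X z = ∃[ x ] (x ∈ X × z ≈ a ∙ x)

  -- Non-emptiness is read as the existence of an element.
  TwoLarge : ∀ {p q} → Subgroup p → Pred Carrier q → Set (c ⊔ ℓ ⊔ p ⊔ q)
  TwoLarge H X =
    X ⊆ ⟦_⟧ ×
    (∀ a b → a ∈ ⟦_⟧ → b ∈ ⟦_⟧ →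
      Satisfiable (LeftTranslate a X ∩ LeftTranslate b X))
    where open Subgroup H

data Letter (V : Set) : Set where
  var  : V → Letter V
  var⁻ : V → Letter V

-- Words need not be reduced.
Word : Set → Set
Word V = List (Letter V)

module _ {c ℓ} (𝔾 : Group c ℓ) where
  open Group 𝔾

  evalLetter : {V : Set} → (V → Carrier) → Letter V → Carrier
  evalLetter ρ (var v)  = ρ v
  evalLetter ρ (var⁻ v) = ρ v ⁻¹

  evalWord : {V : Set} → (V → Carrier) → Word V → Carrier
  evalWord ρ []      = ε
  evalWord ρ (l ∷ w) = evalLetter ρ l ∙ evalWord ρ w

  -- w(x̄, ȳ), where inj₁ i stands for the variable xᵢ and inj₂ j for yⱼ.
  eval₂ : ∀ {n m} → Word (Fin n ⊎ Fin m) →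
          (Fin n → Carrier) → (Fin m → Carrier) → Carrier
  eval₂ w x̄ ȳ = evalWord [ x̄ , ȳ ]′ w

{-# OPTIONS --safe #-}

-- 2-largeness applied to h̄ and the identity gives solutions x̄, ȳ of
-- w(–, ḡ) = d in G with ȳ = h̄x̄.  As h̄ is central, w(h̄x̄, ḡ) = w(h̄, 1̄) w(x̄, ḡ),
-- so d = w(h̄, 1̄) d.

module Submission where

open import Defs
open import Algebra.Bundles using (Group)
import Algebra.Properties.Group as GroupProperties
open import Data.Fin.Base using (Fin)
open import Data.Nat.Base using (ℕ)
open import Data.List.Base using ([]; _∷_)
open import Data.Product.Base using (_,_)
open import Data.Sum.Base using (_⊎_; [_,_])
open import Level using (Level)
import Relation.Binary.Reasoning.Setoid as SetoidReasoning
open import Relation.Unary using (_∈_; _∩_)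

-- Central factors can be collected at the front of a word, each keeping its exponent. Writing the
-- arguments (h̄x̄, ḡ) as (h̄, 1̄) times (x̄, ḡ), this shows that translating by a central h̄
-- multiplies every value of w(-, ḡ) by the one constant w(h̄, 1̄) (`evalWord-∙`). 2-largeness
-- supplies a solution whose translate by h̄ is again a solution, and cancelling the common value
-- leaves w(h̄, 1̄) = 1.

module _ {c ℓ} (𝔾 : Group c ℓ) where
  open Group 𝔾
  open GroupProperties 𝔾
  open SetoidReasoning setoid

  ε-central : ε ∈ Centre 𝔾
  ε-central x = trans (identityˡ x) (sym (identityʳ x))

  ∙-central : ∀ {y z} → y ∈ Centre 𝔾 → z ∈ Centre 𝔾 → y ∙ z ∈ Centre 𝔾
  ∙-central {y} {z} y-central z-central x = begin
    y ∙ z ∙ x    ≈⟨ assoc y z x ⟩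
    y ∙ (z ∙ x)  ≈⟨ ∙-congˡ (z-central x) ⟩
    y ∙ (x ∙ z)  ≈⟨ assoc y x z ⟨
    y ∙ x ∙ z    ≈⟨ ∙-congʳ (y-central x) ⟩
    x ∙ y ∙ z    ≈⟨ assoc x y z ⟩
    x ∙ (y ∙ z)  ∎

  -- Invert both sides of the commutation of `z` with `x ⁻¹`.
  ⁻¹-central : ∀ {z} → z ∈ Centre 𝔾 → z ⁻¹ ∈ Centre 𝔾
  ⁻¹-central {z} z-central x = begin
    z ⁻¹ ∙ x              ≈⟨ ∙-congˡ (⁻¹-involutive x) ⟨
    z ⁻¹ ∙ (x ⁻¹) ⁻¹      ≈⟨ ⁻¹-anti-homo-∙ (x ⁻¹) z ⟨
    (x ⁻¹ ∙ z) ⁻¹         ≈⟨ ⁻¹-cong (z-central (x ⁻¹)) ⟨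
    (z ∙ x ⁻¹) ⁻¹         ≈⟨ ⁻¹-anti-homo-∙ z (x ⁻¹) ⟩
    (x ⁻¹) ⁻¹ ∙ z ⁻¹      ≈⟨ ∙-congʳ (⁻¹-involutive x) ⟩
    x ∙ z ⁻¹              ∎

  -- The inductive step of `evalWord-∙`: `z` is the central value of the tail and moves past the
  -- non-central letter `y`.
  central-interchange : ∀ {z} → z ∈ Centre 𝔾 → ∀ x y t →
                        (x ∙ y) ∙ (z ∙ t) ≈ (x ∙ z) ∙ (y ∙ t)
  central-interchange {z} z-central x y t = begin
    (x ∙ y) ∙ (z ∙ t)  ≈⟨ assoc x y (z ∙ t) ⟩
    x ∙ (y ∙ (z ∙ t))  ≈⟨ ∙-congˡ (assoc y z t) ⟨
    x ∙ (y ∙ z ∙ t)    ≈⟨ ∙-congˡ (∙-congʳ (z-central y)) ⟨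
    x ∙ (z ∙ y ∙ t)    ≈⟨ ∙-congˡ (assoc z y t) ⟩
    x ∙ (z ∙ (y ∙ t))  ≈⟨ assoc x z (y ∙ t) ⟨
    (x ∙ z) ∙ (y ∙ t)  ∎

  module _ {V : Set} {ρ : V → Carrier} (ρ-central : ∀ v → ρ v ∈ Centre 𝔾) where

    evalLetter-central : ∀ l → evalLetter 𝔾 ρ l ∈ Centre 𝔾
    evalLetter-central (var v)  = ρ-central v
    evalLetter-central (var⁻ v) = ⁻¹-central (ρ-central v)

    evalWord-central : ∀ w → evalWord 𝔾 ρ w ∈ Centre 𝔾
    evalWord-central []      = ε-central
    evalWord-central (l ∷ w) = ∙-central (evalLetter-central l) (evalWord-central w)

    module _ {σ τ : V → Carrier} (τ≈ρσ : ∀ v → τ v ≈ ρ v ∙ σ v) where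

      evalLetter-∙ : ∀ l → evalLetter 𝔾 τ l ≈ evalLetter 𝔾 ρ l ∙ evalLetter 𝔾 σ l
      evalLetter-∙ (var v)  = τ≈ρσ v
      evalLetter-∙ (var⁻ v) = begin
        τ v ⁻¹           ≈⟨ ⁻¹-cong (τ≈ρσ v) ⟩
        (ρ v ∙ σ v) ⁻¹   ≈⟨ ⁻¹-anti-homo-∙ (ρ v) (σ v) ⟩
        -- Inversion has reversed the factors; centrality restores their order.
        σ v ⁻¹ ∙ ρ v ⁻¹  ≈⟨ ⁻¹-central (ρ-central v) (σ v ⁻¹) ⟨
        ρ v ⁻¹ ∙ σ v ⁻¹  ∎

      -- The assignment `τ` is kept separate from the product of `ρ` and `σ` because in the
      -- application it agrees with that product only up to `≈`.
      evalWord-∙ : ∀ w → evalWord 𝔾 τ w ≈ evalWord 𝔾 ρ w ∙ evalWord 𝔾 σ w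
      evalWord-∙ []      = sym (identityˡ ε)
      evalWord-∙ (l ∷ w) = trans
        (∙-cong (evalLetter-∙ l) (evalWord-∙ w))
        (central-interchange (evalWord-central w) _ _ _)

theorem3p9 : ∀ {c ℓ p : Level} (G₁ : Group c ℓ) (n m : ℕ) →
    let open Group G₁ in
    (G : Subgroup (G₁ ^ᴳ n) p)
    (w : Word (Fin n ⊎ Fin m))
    (ḡ : Fin m → Carrier) (d : Carrier) →
    TwoLarge (G₁ ^ᴳ n) G (Subgroup.⟦_⟧ G ∩ (λ h̄ → eval₂ G₁ w h̄ ḡ ≈ d)) →
    ∀ (h̄ : Fin n → Carrier) →
    h̄ ∈ Subgroup.⟦_⟧ G → (∀ i → h̄ i ∈ Centre G₁) →
    eval₂ G₁ w h̄ (λ _ → ε) ≈ ε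
theorem3p9 G₁ n m G w ḡ d (_ , meet) h̄ h̄∈G h̄-central
  with meet h̄ (λ _ → Group.ε G₁) h̄∈G (Subgroup.ε-closed G)
... | z̄ , (x̄ , (_ , wx̄≈d) , z̄≈h̄x̄) , (ȳ , (_ , wȳ≈d) , z̄≈ȳ) =
  identityˡ-unique (eval₂ G₁ w h̄ (λ _ → ε)) d (begin
    eval₂ G₁ w h̄ (λ _ → ε) ∙ d               ≈⟨ ∙-congˡ wx̄≈d ⟨
    eval₂ G₁ w h̄ (λ _ → ε) ∙ eval₂ G₁ w x̄ ḡ  ≈⟨ evalWord-∙ G₁ central product w ⟨
    eval₂ G₁ w ȳ ḡ                           ≈⟨ wȳ≈d ⟩
    d                                        ∎)
  where
  open Group G₁
  open GroupProperties G₁ using (identityˡ-unique)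
  open SetoidReasoning setoid

  -- The central assignment is h̄ on the x-variables and 1 on the y-variables, so that ḡ stays
  -- fixed.
  central = [ h̄-central , (λ _ → ε-central G₁) ]

  -- `z̄≈ȳ` comes from the translate by the identity, so it equates `z̄ i` with `ε ∙ ȳ i`.
  product = [ (λ i → trans (sym (trans (z̄≈ȳ i) (identityˡ (ȳ i)))) (z̄≈h̄x̄ i))
            , (λ j → sym (identityˡ (ḡ j))) ]
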